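{- Let $n\ge 5$ and let $x,y$ be adjacent vertices of $Q_n$ with $f_n(x)+f_n(y)=\operatorname{str}_{f_n}(Q_n)$. If $x$ and $y$ both begin with the bit $0$, then $$\operatorname{str}_{f_n}(Q_n)\le \operatorname{str}_{f_{n-2}}(Q_{n-2})+3\cdot 2^{n-2}+\binom{n-3}{\lceil (n-3)/2\rceil}+\binom{n-2}{\lceil (n-2)/2\rceil}.$$
   Context: $Q_n$ is the $n$-dimensional hypercube: vertices are the $n$-bit strings, adjacent iff they differ in exactly one position. For a bijection $f:V(G)\to\{1,\dots,|V(G)|\}$, $\operatorname{str}_f(G)=\max\{f(u)+f(v):uv\in E(G)\}$. An $n$-bit string is $x_1\cdots x_n$, $x_i\in\{0,1\}$; its weight is its number of $1$s. Lexicographic order: $x<y$ if for some $k$, $x_j=y_j$ for $j<k$ and $x_k<y_k$. $S_n^i$ is the sequence of $n$-bit strings of weight $i$ in increasing lexicographic order; $R_n^i$ is the same set in decreasing lexicographic order. $S_n$ is the concatenation $(R_n^1,R_n^3,\dots,R_n^{n-1},S_n^n,S_n^{n-2},\dots,S_n^2,S_n^0)$ for even $n$ and $(R_n^1,R_n^3,\dots,R_n^{n-2},R_n^n,S_n^{n-1},\dots,S_n^2,S_n^0)$ for odd $n$; $f_n$ maps the string in position $j$ of $S_n$ to $j$. -}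

module Defs where

open import Data.Bool.Base using (Bool; true; false; _xor_; _<_; f<t)
open import Data.Bool.Properties using (xor-comm)
import Data.Bool.Properties as Bool
open import Data.Empty using (⊥)
open import Data.Fin.Base using (Fin; zero; suc; toℕ; cast)
open import Data.Fin.Properties using (toℕ-injective; toℕ-cast; injective⇒≤)
open import Data.List.Base using (List; []; _∷_; _++_; map; concat; filter; reverse; length; lookup; upTo; cartesianProduct)
open import Data.List.Extrema.Nat using (max)
open import Data.List.Membership.Propositional using (_∈_)
open import Data.List.Membership.Propositional.Properties using (∈-map⁺; ∈-++⁺ˡ; ∈-++⁺ʳ; ∈-filter⁺; ∈-filter⁻; ∈-concat⁺′; ∈-upTo⁺; ∈-lookup)
open import Data.List.Relation.Binary.Disjoint.Propositional using (Disjoint)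
open import Data.List.Relation.Unary.All as All using (All; []; _∷_)
import Data.List.Relation.Unary.All.Properties as All
open import Data.List.Relation.Unary.AllPairs as AllPairs using (AllPairs; []; _∷_)
import Data.List.Relation.Unary.AllPairs.Properties as AllPairs
open import Data.List.Relation.Unary.Any using (here; there; index)
open import Data.List.Relation.Unary.Any.Properties using (lookup-index; reverse⁺; reverse⁻)
open import Data.List.Relation.Unary.Unique.Propositional using (Unique)
import Data.List.Relation.Unary.Unique.Propositional.Properties as Unique
open import Data.List.Properties using (unfold-reverse)
open import Data.Nat.Base using (ℕ; zero; suc; _+_; _≤_; s≤s)
open import Data.Nat.DivMod using (_%_; m%n<n)
open import Data.Nat.Properties using (_≟_; ≤-antisym)
open import Data.Product.Base using (_×_; _,_; ∃-syntax; proj₂; uncurry)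
open import Data.Vec.Base using (Vec; []; _∷_; count; zipWith)
open import Data.Vec.Properties using (count≤n; zipWith-comm)
import Data.Vec.Relation.Binary.Pointwise.Inductive as Pointwise
open import Data.Vec.Relation.Binary.Lex.Strict using (Lex-<; this; next; <-irrefl)
open import Function.Base using (flip; _∘_)
open import Function.Bundles using (_⤖_; mk⤖; Bijection)
open import Function.Consequences.Propositional using (strictlySurjective⇒surjective)
open import Level using (0ℓ)
open import Relation.Binary.Core using (Rel)
open import Relation.Binary.Definitions using (Symmetric; Decidable)
open import Relation.Binary.PropositionalEquality using (_≡_; _≢_; refl; sym; trans; cong; module ≡-Reasoning)
open import Relation.Nullary using (¬_; contradiction)

record FiniteGraph : Set₁ where
  field
    Vertex   : Set
    vertices : List Vertex
    unique   : Unique vertices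
    complete : ∀ v → v ∈ vertices
    Adj      : Rel Vertex 0ℓ
    adj?     : Decidable Adj
    symm     : Symmetric Adj
    loopless : ∀ v → ¬ Adj v v

  order : ℕ
  order = length vertices

  -- Every edge occurs in both orientations.
  edges : List (Vertex × Vertex)
  edges = filter (uncurry adj?) (cartesianProduct vertices vertices)

open FiniteGraph public using (Vertex; order; Adj)

Numbering : FiniteGraph → Set
Numbering G = Vertex G ⤖ Fin (order G)

-- Fin is 0-based, whereas the labels are 1, …, |V(G)|.
label : ∀ G → Numbering G → Vertex G → ℕ
label G f v = suc (toℕ (Bijection.to f v))

-- The seed 0 of the maximum only matters for edgeless graphs, since all
-- labels are positive.
str : ∀ G → Numbering G → ℕ
str G f = max 0 (map (λ (u , v) → label G f u + label G f v) (FiniteGraph.edges G))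

BitString : ℕ → Set
BitString = Vec Bool

weight : ∀ {n} → BitString n → ℕ
weight = count (Bool._≟ true)

BeginsWith : ∀ {n} → Bool → BitString n → Set
BeginsWith b []      = ⊥
BeginsWith b (c ∷ _) = c ≡ b

_<ₗₑₓ_ : ∀ {n} → Rel (BitString n) 0ℓ
_<ₗₑₓ_ = Lex-< _≡_ _<_

-- All n-bit strings, in increasing lexicographic order (see strings-increasing).
strings : ∀ n → List (BitString n)
strings zero    = [] ∷ []
strings (suc n) = map (false ∷_) (strings n) ++ map (true ∷_) (strings n)

strings-increasing : ∀ n → AllPairs _<ₗₑₓ_ (strings n)
strings-increasing zero    = [] ∷ []
strings-increasing (suc n) = AllPairs.++⁺
  (AllPairs.map⁺ (AllPairs.map (next refl) (strings-increasing n)))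
  (AllPairs.map⁺ (AllPairs.map (next refl) (strings-increasing n)))
  (All.map⁺ (All.universal (λ _ → All.map⁺ (All.universal (λ _ → this f<t refl) _)) _))

increasing⇒unique : ∀ {n} {xs : List (BitString n)} → AllPairs _<ₗₑₓ_ xs → Unique xs
increasing⇒unique = AllPairs.map (λ { x<x refl → <-irrefl Bool.<-irrefl (Pointwise.refl refl) x<x })

strings-complete : ∀ {n} (x : BitString n) → x ∈ strings n
strings-complete []          = here refl
strings-complete (false ∷ x) = ∈-++⁺ˡ (∈-map⁺ (false ∷_) (strings-complete x))
strings-complete (true ∷ x)  = ∈-++⁺ʳ _ (∈-map⁺ (true ∷_) (strings-complete x))

-- The number of positions in which two strings differ.
distance : ∀ {n} → BitString n → BitString n → ℕ
distance x y = weight (zipWith _xor_ x y)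

distance-refl : ∀ {n} (x : BitString n) → distance x x ≡ 0
distance-refl []          = refl
distance-refl (false ∷ x) = distance-refl x
distance-refl (true ∷ x)  = distance-refl x

distance-comm : ∀ {n} (x y : BitString n) → distance x y ≡ distance y x
distance-comm x y = cong weight (zipWith-comm xor-comm x y)

Q : ℕ → FiniteGraph
Q n = record
  { Vertex   = BitString n
  ; vertices = strings n
  ; unique   = increasing⇒unique (strings-increasing n)
  ; complete = strings-complete
  ; Adj      = λ x y → distance x y ≡ 1
  ; adj?     = λ x y → distance x y ≟ 1
  ; symm     = λ {x} {y} d≡1 → trans (distance-comm y x) d≡1
  ; loopless = λ x d≡1 → contradiction (trans (sym (distance-refl x)) d≡1) λ ()
  }

Sᵂ : ∀ n → ℕ → List (BitString n)
Sᵂ n i = filter (λ x → weight x ≟ i) (strings n)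

Rᵂ : ∀ n → ℕ → List (BitString n)
Rᵂ n i = reverse (Sᵂ n i)

oddWeights : ℕ → List ℕ
oddWeights n = filter (λ i → i % 2 ≟ 1) (upTo (suc n))

evenWeights : ℕ → List ℕ
evenWeights n = filter (λ i → i % 2 ≟ 0) (upTo (suc n))

-- For n of either parity the sequence runs through the odd weights ≤ n upwards
-- and then through the even weights ≤ n downwards.
blocks : ∀ n → List (List (BitString n))
blocks n = map (Rᵂ n) (oddWeights n) ++ map (Sᵂ n) (reverse (evenWeights n))

S : ∀ n → List (BitString n)
S n = concat (blocks n)

AllPairs-reverse : ∀ {A : Set} {_~_ : Rel A 0ℓ} {xs} → AllPairs _~_ xs → AllPairs (flip _~_) (reverse xs)
AllPairs-reverse []                            = []
AllPairs-reverse {xs = x ∷ xs} (x~xs ∷ xs~xs)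
  rewrite unfold-reverse x xs =
  AllPairs.++⁺ (AllPairs-reverse xs~xs) ([] ∷ []) (All.tabulate λ y∈ → All.lookup x~xs (reverse⁻ y∈) ∷ [])

Sᵂ-increasing : ∀ n i → AllPairs _<ₗₑₓ_ (Sᵂ n i)
Sᵂ-increasing n i = AllPairs.filter⁺ (λ x → weight x ≟ i) (strings-increasing n)

Rᵂ-decreasing : ∀ n i → AllPairs (flip _<ₗₑₓ_) (Rᵂ n i)
Rᵂ-decreasing n i = AllPairs-reverse (Sᵂ-increasing n i)

∈-Sᵂ⁺ : ∀ {n i} {x : BitString n} → weight x ≡ i → x ∈ Sᵂ n i
∈-Sᵂ⁺ {i = i} {x} = ∈-filter⁺ (λ y → weight y ≟ i) (strings-complete x)

∈-Sᵂ⁻ : ∀ {n i} {x : BitString n} → x ∈ Sᵂ n i → weight x ≡ i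
∈-Sᵂ⁻ {n} {i} x∈ = proj₂ (∈-filter⁻ (λ y → weight y ≟ i) {xs = strings n} x∈)

∈-Rᵂ⁺ : ∀ {n i} {x : BitString n} → weight x ≡ i → x ∈ Rᵂ n i
∈-Rᵂ⁺ = reverse⁺ ∘ ∈-Sᵂ⁺

∈-Rᵂ⁻ : ∀ {n i} {x : BitString n} → x ∈ Rᵂ n i → weight x ≡ i
∈-Rᵂ⁻ = ∈-Sᵂ⁻ ∘ reverse⁻

S-complete : ∀ {n} (x : BitString n) → x ∈ S n
S-complete {n} x with weight x % 2 in eq | m%n<n (weight x) 2
... | 0 | _ = ∈-concat⁺′ (∈-Sᵂ⁺ refl)
  (∈-++⁺ʳ (map (Rᵂ n) (oddWeights n)) (∈-map⁺ (Sᵂ n) (reverse⁺ (∈-filter⁺ (λ i → i % 2 ≟ 0) (∈-upTo⁺ (s≤s (count≤n (Bool._≟ true) x))) eq))))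
... | 1 | _ = ∈-concat⁺′ (∈-Rᵂ⁺ refl)
  (∈-++⁺ˡ (∈-map⁺ (Rᵂ n) (∈-filter⁺ (λ i → i % 2 ≟ 1) (∈-upTo⁺ (s≤s (count≤n (Bool._≟ true) x))) eq)))
... | suc (suc _) | s≤s (s≤s ())

S-unique : ∀ n → Unique (S n)
S-unique n = Unique.concat⁺ {xss = blocks n}
  (All.++⁺ (All.map⁺ (All.universal R! (oddWeights n))) (All.map⁺ (All.universal S! (reverse (evenWeights n)))))
  (AllPairs.++⁺
    (AllPairs.map⁺ (AllPairs.map (disjoint ∈-Rᵂ⁻ ∈-Rᵂ⁻) odd!))
    (AllPairs.map⁺ (AllPairs.map (disjoint ∈-Sᵂ⁻ ∈-Sᵂ⁻) even!))
    (All.map⁺ (All.tabulate λ i∈ → All.map⁺ (All.tabulate λ j∈ →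
      disjoint ∈-Rᵂ⁻ ∈-Sᵂ⁻ (odd≢even i∈ (reverse⁻ j∈))))))
  where
  disjoint : ∀ {i j} {xs ys : List (BitString n)} → (∀ {x} → x ∈ xs → weight x ≡ i) →
             (∀ {x} → x ∈ ys → weight x ≡ j) → i ≢ j → Disjoint xs ys
  disjoint wx wy i≢j (x∈xs , x∈ys) = i≢j (trans (sym (wx x∈xs)) (wy x∈ys))

  S! : ∀ i → Unique (Sᵂ n i)
  S! i = increasing⇒unique (Sᵂ-increasing n i)

  R! : ∀ i → Unique (Rᵂ n i)
  R! i = AllPairs.map (_∘ sym) (AllPairs-reverse (S! i))

  odd! : Unique (oddWeights n)
  odd! = Unique.filter⁺ (λ i → i % 2 ≟ 1) (Unique.upTo⁺ (suc n))

  even! : Unique (reverse (evenWeights n))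
  even! = AllPairs.map (_∘ sym) (AllPairs-reverse (Unique.filter⁺ (λ i → i % 2 ≟ 0) (Unique.upTo⁺ (suc n))))

  odd≢even : ∀ {i j} → i ∈ oddWeights n → j ∈ evenWeights n → i ≢ j
  odd≢even i∈ j∈ refl with trans (sym (proj₂ (∈-filter⁻ (λ i → i % 2 ≟ 1) {xs = upTo (suc n)} i∈))) (proj₂ (∈-filter⁻ (λ i → i % 2 ≟ 0) {xs = upTo (suc n)} j∈))
  ... | ()

unique⇒lookup-injective : ∀ {A : Set} {xs : List A} → Unique xs → ∀ i j → lookup xs i ≡ lookup xs j → i ≡ j
unique⇒lookup-injective (_ ∷ _)      zero    zero    _  = refl
unique⇒lookup-injective (x∉xs ∷ _)   zero    (suc j) eq = contradiction eq (All.lookup x∉xs (∈-lookup j))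
unique⇒lookup-injective (x∉xs ∷ _)   (suc i) zero    eq = contradiction (sym eq) (All.lookup x∉xs (∈-lookup i))
unique⇒lookup-injective (_ ∷ xs!)    (suc i) (suc j) eq = cong suc (unique⇒lookup-injective xs! i j eq)

index-injective : ∀ {A : Set} {xs : List A} {x y} (p : x ∈ xs) (q : y ∈ xs) → index p ≡ index q → x ≡ y
index-injective {xs = xs} p q eq = trans (lookup-index p) (trans (cong (lookup xs) eq) (sym (lookup-index q)))

unique⇒length≤ : ∀ {A : Set} {xs ys : List A} → Unique xs → (∀ x → x ∈ ys) → length xs ≤ length ys
unique⇒length≤ {xs = xs} xs! ∈ys = injective⇒≤ {f = λ i → index (∈ys (lookup xs i))}
  (λ {i} {j} eq → unique⇒lookup-injective xs! i j (index-injective (∈ys _) (∈ys _) eq))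

length-S : ∀ n → length (S n) ≡ order (Q n)
length-S n = ≤-antisym
  (unique⇒length≤ (S-unique n) strings-complete)
  (unique⇒length≤ (increasing⇒unique (strings-increasing n)) S-complete)

position : ∀ n → BitString n → Fin (order (Q n))
position n x = cast (length-S n) (index (S-complete x))

f : ∀ n → Numbering (Q n)
f n = mk⤖ (injective , strictlySurjective⇒surjective surjective)
  where
  cast-injective : ∀ {i j} → cast (length-S n) i ≡ cast (length-S n) j → i ≡ j
  cast-injective {i} {j} eq = toℕ-injective
    (trans (sym (toℕ-cast (length-S n) i)) (trans (cong toℕ eq) (toℕ-cast (length-S n) j)))

  injective : ∀ {x y} → position n x ≡ position n y → x ≡ y
  injective {x} {y} eq = index-injective (S-complete x) (S-complete y) (cast-injective eq)

  surjective : ∀ i → ∃[ x ] position n x ≡ i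
  surjective i = x , toℕ-injective (begin
    toℕ (position n x)             ≡⟨ toℕ-cast (length-S n) _ ⟩
    toℕ (index (S-complete x))     ≡⟨ cong toℕ (unique⇒lookup-injective (S-unique n) _ i′ (sym (lookup-index (S-complete x)))) ⟩
    toℕ i′                         ≡⟨ toℕ-cast (sym (length-S n)) i ⟩
    toℕ i                          ∎)
    where
    open ≡-Reasoning
    i′ = cast (sym (length-S n)) i
    x  = lookup (S n) i′

{-# OPTIONS --safe #-}
-- Order all strings by weight and then decreasingly in lexicographic order.
-- An odd string is labelled by the number of odd strings up to it, an even
-- string by 2ⁿ minus the number of even strings before it.  For an edge whose
-- ends share a prefix of length p, summing these counts along that prefix
-- with Pascal's rule gives f(x) + f(y) = 2ⁿ + 1 ± T, where T is the sum, over
-- q < p, of the binomials C (n − 2 − q) w with w the smaller weight of the two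
-- tails that remain after deleting the first q + 1 bits; the sign is + exactly
-- when the lighter end is even.  T ignores the first bit of the edge, so
-- flipping that bit makes the lighter end even: hence 2ⁿ + 1 + T ≤ str for
-- every edge.  Deleting the first two bits of an edge of Qₙ removes at most two
-- terms of T, each bounded by a central binomial coefficient.
module Submission where

open import Defs
open import Data.Bool.Base using (Bool; true; false)
import Data.Bool.Properties as Bool
open import Data.Empty using (⊥)
open import Data.Fin.Base using (toℕ)
open import Data.Fin.Properties using (toℕ-cast)
open import Data.List.Base using (List; []; _∷_; _∷ʳ_; [_]; _++_; map; concat; filter; reverse; length; upTo)
open import Data.List.Extrema.Nat using (xs≤max)
open import Data.List.Membership.Propositional using (_∈_)
open import Data.List.Membership.Propositional.Properties using (∈-map⁺; ∈-++⁺ʳ; ∈-filter⁺; ∈-cartesianProduct⁺)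
open import Data.List.Properties using (length-++; length-map; length-reverse; map-++; ++-assoc; ++-identityʳ; concat-++; reverse-++; unfold-reverse; reverse-map; upTo-∷ʳ; filter-++; filter-accept; filter-reject; filter-none; filter-≐)
open import Data.List.Relation.Unary.All as All using (_∷_)
open import Data.List.Relation.Unary.AllPairs using (_∷_)
open import Data.List.Relation.Unary.Any using (here; there; index)
open import Data.List.Relation.Unary.Unique.Propositional using (Unique)
open import Data.Nat.Base using (ℕ; zero; suc; _+_; _*_; _∸_; _^_; _≤_; _<_; z≤n; s≤s; ⌈_/2⌉; ⌊_/2⌋)
open import Data.Nat.Combinatorics using (_C_; nCk+nC[k+1]≡[n+1]C[k+1]; nCk≡nC[n∸k]; k>n⇒nCk≡0)
open import Data.Nat.DivMod using (_%_)
open import Data.Nat.Properties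
open import Data.Nat.Tactic.RingSolver using (solve-∀)
open import Data.Product.Base using (∃-syntax; _×_; _,_; uncurry)
open import Data.Sum.Base as Sum using (_⊎_; inj₁; inj₂; [_,_]′)
open import Data.Vec.Base using ([]; _∷_; replicate)
open import Data.Vec.Properties using (count≤n)
open import Function.Base using (_∘_)
open import Level using (0ℓ)
open import Relation.Binary.PropositionalEquality using (_≡_; refl; sym; trans; cong; cong₂; subst; subst₂; module ≡-Reasoning)
open import Relation.Nullary using (contradiction; yes; no)
open import Relation.Unary using (Pred; Decidable)

private
  variable
    A B : Set

-- Binomial coefficients

-- The hypotheses say that `l` is no farther from n/2 than `k`. Pascal's rule splits both sides, and
-- the summands are compared crosswise: `n C k` with `n C suc l`, and `n C suc k` with `n C l`. Both
-- pairs again satisfy the hypotheses.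
nCk≤nCl : ∀ n {k l} → k ≤ l → k + l ≤ n → n C k ≤ n C l
nCk≤nCl n {zero} {zero} k≤l k+l≤n = ≤-refl
nCk≤nCl (suc n) {zero} {suc l} k≤l (s≤s l≤n) = begin
  n C 0                 ≤⟨ nCk≤nCl n z≤n l≤n ⟩
  n C l                 ≤⟨ m≤m+n _ _ ⟩
  n C l + n C suc l     ≡⟨ nCk+nC[k+1]≡[n+1]C[k+1] n l ⟩
  suc n C suc l         ∎
  where open ≤-Reasoning
nCk≤nCl (suc n) {suc k} {suc l} (s≤s k≤l) (s≤s k+1+l≤n) with m≤n⇒m<n∨m≡n k≤l
... | inj₂ refl = ≤-refl
... | inj₁ k<l  = begin
  suc n C suc k         ≡⟨ nCk+nC[k+1]≡[n+1]C[k+1] n k ⟨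
  n C k + n C suc k     ≤⟨ +-mono-≤ (nCk≤nCl n (m≤n⇒m≤1+n k≤l) k+1+l≤n) (nCk≤nCl n k<l (≤-trans (≤-reflexive (sym (+-suc k l))) k+1+l≤n)) ⟩
  n C suc l + n C l     ≡⟨ +-comm (n C suc l) _ ⟩
  n C l + n C suc l     ≡⟨ nCk+nC[k+1]≡[n+1]C[k+1] n l ⟩
  suc n C suc l         ∎
  where open ≤-Reasoning

⌈n/2⌉≤1+⌊n/2⌋ : ∀ n → ⌈ n /2⌉ ≤ suc ⌊ n /2⌋
⌈n/2⌉≤1+⌊n/2⌋ zero          = z≤n
⌈n/2⌉≤1+⌊n/2⌋ (suc zero)    = ≤-refl
⌈n/2⌉≤1+⌊n/2⌋ (suc (suc n)) = s≤s (⌈n/2⌉≤1+⌊n/2⌋ n)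

-- An index above `⌊ n /2⌋` is first reflected to `n ∸ k`, which is at most `⌈ n /2⌉`, so that
-- `nCk≤nCl` applies on either side of the middle.
nCk≤nC⌈n/2⌉ : ∀ n k → n C k ≤ n C ⌈ n /2⌉
nCk≤nC⌈n/2⌉ n k with k ≤? ⌊ n /2⌋ | k ≤? n
... | yes k≤ | _ = nCk≤nCl n (≤-trans k≤ (⌊n/2⌋≤⌈n/2⌉ n))
                     (≤-trans (+-monoˡ-≤ _ k≤) (≤-reflexive (⌊n/2⌋+⌈n/2⌉≡n n)))
... | no  _  | no  k≰n = ≤-trans (≤-reflexive (k>n⇒nCk≡0 (≰⇒> k≰n))) z≤n
... | no  k≰ | yes k≤n = ≤-trans (≤-reflexive (nCk≡nC[n∸k] k≤n)) (nCk≤nCl n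
  (begin
    n ∸ k                           ≤⟨ ∸-monoʳ-≤ n (<⇒≤ (≰⇒> k≰)) ⟩
    n ∸ ⌊ n /2⌋                     ≡⟨ cong (_∸ ⌊ n /2⌋) (⌊n/2⌋+⌈n/2⌉≡n n) ⟨
    ⌊ n /2⌋ + ⌈ n /2⌉ ∸ ⌊ n /2⌋     ≡⟨ m+n∸m≡n ⌊ n /2⌋ _ ⟩
    ⌈ n /2⌉                         ∎)
  (begin
    n ∸ k + ⌈ n /2⌉                 ≤⟨ +-monoʳ-≤ (n ∸ k) (≤-trans (⌈n/2⌉≤1+⌊n/2⌋ n) (≰⇒> k≰)) ⟩
    n ∸ k + k                       ≡⟨ m∸n+n≡m k≤n ⟩
    n                               ∎))
  where open ≤-Reasoning

infixl 6.5 _C⁻_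

-- n choose (k − 1), which is 0 for k = 0.
_C⁻_ : ℕ → ℕ → ℕ
n C⁻ zero  = 0
n C⁻ suc k = n C k

C⁻-pascal : ∀ n k → n C⁻ k + n C k ≡ suc n C k
C⁻-pascal n zero    = refl
C⁻-pascal n (suc k) = nCk+nC[k+1]≡[n+1]C[k+1] n k

-- The sum of n C j over all j < k with j ≡ k (mod 2).
strideSum : ℕ → ℕ → ℕ
strideSum n zero          = 0
strideSum n (suc zero)    = 0
strideSum n (suc (suc k)) = strideSum n k + n C k

-- By Pascal's rule, `strideSum (suc n) k` is the sum of `n C i` over all i with i + 1 < k, of
-- either parity. Raising `k` by one therefore adds a single term.
strideSum-suc : ∀ n k → strideSum (suc n) (suc k) ≡ strideSum (suc n) k + n C⁻ k
strideSum-suc n zero    = refl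
strideSum-suc n (suc k) = begin
  strideSum (suc n) k + suc n C k              ≡⟨ cong (strideSum (suc n) k +_) (C⁻-pascal n k) ⟨
  strideSum (suc n) k + (n C⁻ k + n C k)       ≡⟨ +-assoc (strideSum (suc n) k) (n C⁻ k) (n C k) ⟨
  strideSum (suc n) k + n C⁻ k + n C k         ≡⟨ cong (_+ n C k) (strideSum-suc n k) ⟨
  strideSum (suc n) (suc k) + n C k            ∎
  where open ≡-Reasoning

-- Positions in lists

reverse-∷ : ∀ (xs : List A) {x ys} → reverse (xs ++ x ∷ ys) ≡ reverse ys ++ x ∷ reverse xs
reverse-∷ xs {x} {ys} = begin
  reverse (xs ++ x ∷ ys)              ≡⟨ reverse-++ xs (x ∷ ys) ⟩
  reverse (x ∷ ys) ++ reverse xs      ≡⟨ cong (_++ reverse xs) (unfold-reverse x ys) ⟩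
  (reverse ys ∷ʳ x) ++ reverse xs     ≡⟨ ++-assoc (reverse ys) [ x ] (reverse xs) ⟩
  reverse ys ++ x ∷ reverse xs        ∎
  where open ≡-Reasoning

-- Positions are given by a splitting of the list, which behaves well under `++`, `map` and
-- `reverse`. Odd strings are counted from the front of `S n`, even ones from the back, hence the
-- twin `After`.
Before : ℕ → A → List A → Set
Before k x xs = ∃[ pre ] ∃[ suf ] xs ≡ pre ++ x ∷ suf × length pre ≡ k

After : ℕ → A → List A → Set
After k x xs = ∃[ pre ] ∃[ suf ] xs ≡ pre ++ x ∷ suf × length suf ≡ k

After-++ʳ : ∀ xs {k} {x : A} {ys} → After k x ys → After k x (xs ++ ys)
After-++ʳ xs (pre , suf , refl , k≡) = xs ++ pre , suf , sym (++-assoc xs pre _) , k≡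

After-++ˡ : ∀ {k} {x : A} {xs} ys → After k x xs → After (length ys + k) x (xs ++ ys)
After-++ˡ {x = x} ys (pre , suf , refl , refl) =
  pre , suf ++ ys , ++-assoc pre (x ∷ suf) ys , trans (length-++ suf) (+-comm (length suf) (length ys))

Before-++ˡ : ∀ {k} {x : A} {xs} ys → Before k x xs → Before k x (xs ++ ys)
Before-++ˡ {x = x} ys (pre , suf , refl , k≡) = pre , suf ++ ys , ++-assoc pre (x ∷ suf) ys , k≡

Before-++ʳ : ∀ xs {k} {x : A} {ys} → Before k x ys → Before (length xs + k) x (xs ++ ys)
Before-++ʳ xs (pre , suf , refl , refl) = xs ++ pre , suf , sym (++-assoc xs pre _) , length-++ xs

After-map : ∀ (g : A → B) {k x xs} → After k x xs → After k (g x) (map g xs)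
After-map g (pre , suf , refl , refl) = map g pre , map g suf , map-++ g pre _ , length-map g suf

After⇒Before-reverse : ∀ {k} {x : A} {xs} → After k x xs → Before k x (reverse xs)
After⇒Before-reverse (pre , suf , refl , refl) = reverse suf , reverse pre , reverse-∷ pre , length-reverse suf

-- Without repetitions every membership proof points at the same occurrence. This evaluates the
-- index of `S-complete x`, on which `f` is built, without unfolding that proof.
index-unique : ∀ {xs : List A} {x} → Unique xs → (p : x ∈ xs) → ∀ pre {suf} →
               xs ≡ pre ++ x ∷ suf → toℕ (index p) ≡ length pre
index-unique _           (here _)    []        _    = refl
index-unique (x∉ ∷ _)    (there p)   []        refl = contradiction refl (All.lookup x∉ p)
index-unique (x∉ ∷ _)    (here refl) (_ ∷ pre) refl = contradiction refl (All.lookup x∉ (∈-++⁺ʳ pre (here refl)))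
index-unique (_ ∷ xs!)   (there p)   (_ ∷ pre) refl = cong suc (index-unique xs! p pre refl)

length-concat-reverse : ∀ (xss : List (List A)) → length (concat (reverse xss)) ≡ length (concat xss)
length-concat-reverse []         = refl
length-concat-reverse (xs ∷ xss) = begin
  length (concat (reverse (xs ∷ xss)))                 ≡⟨ cong (length ∘ concat) (unfold-reverse xs xss) ⟩
  length (concat (reverse xss ∷ʳ xs))                  ≡⟨ cong length (concat-++ (reverse xss) [ xs ]) ⟨
  length (concat (reverse xss) ++ concat [ xs ])       ≡⟨ length-++ (concat (reverse xss)) ⟩
  length (concat (reverse xss)) + length (xs ++ [])    ≡⟨ cong₂ _+_ (length-concat-reverse xss) (trans (length-++ xs) (+-identityʳ _)) ⟩
  length (concat xss) + length xs                      ≡⟨ +-comm (length (concat xss)) _ ⟩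
  length xs + length (concat xss)                      ≡⟨ length-++ xs ⟨
  length (xs ++ concat xss)                            ∎
  where open ≡-Reasoning

concat-map-++ : ∀ (g : A → List B) xs {y ys} →
                concat (map g (xs ++ y ∷ ys)) ≡ concat (map g xs) ++ g y ++ concat (map g ys)
concat-map-++ g xs {y} {ys} = trans (cong concat (map-++ g xs (y ∷ ys))) (sym (concat-++ (map g xs) (map g (y ∷ ys))))

concat-map-reverse : ∀ (g : A → List B) xs {y ys} →
                     concat (map g (reverse (xs ++ y ∷ ys))) ≡
                     concat (map g (reverse ys)) ++ g y ++ concat (map g (reverse xs))
concat-map-reverse g xs {ys = ys} = trans (cong (concat ∘ map g) (reverse-∷ xs)) (concat-map-++ g (reverse ys))

filter-map : ∀ {P : Pred B 0ℓ} (P? : Decidable P) (g : A → B) xs → filter P? (map g xs) ≡ map g (filter (P? ∘ g) xs)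
filter-map P? g []       = refl
filter-map P? g (x ∷ xs) with P? (g x)
... | yes _ = cong (g x ∷_) (filter-map P? g xs)
... | no  _ = filter-map P? g xs

-- Applied to the weights of one parity, this isolates the block of weight `k` and identifies the
-- blocks of smaller weight.
filter-upTo-split : ∀ {P : Pred ℕ 0ℓ} (P? : Decidable P) {k} → P k → ∀ n → k < n →
                    ∃[ suf ] filter P? (upTo n) ≡ filter P? (upTo k) ++ k ∷ suf
filter-upTo-split P? {k} Pk (suc n) k<1+n with m<1+n⇒m<n∨m≡n k<1+n
... | inj₂ refl = [] , (begin
  filter P? (upTo (suc k))                      ≡⟨ cong (filter P?) (upTo-∷ʳ k) ⟨
  filter P? (upTo k ∷ʳ k)                       ≡⟨ filter-++ P? (upTo k) [ k ] ⟩
  filter P? (upTo k) ++ filter P? [ k ]         ≡⟨ cong (filter P? (upTo k) ++_) (filter-accept P? Pk) ⟩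
  filter P? (upTo k) ++ [ k ]                   ∎)
  where open ≡-Reasoning
... | inj₁ k<n with filter-upTo-split P? Pk n k<n
... | suf , eq = suf ++ filter P? [ n ] , (begin
  filter P? (upTo (suc n))                                ≡⟨ cong (filter P?) (upTo-∷ʳ n) ⟨
  filter P? (upTo n ∷ʳ n)                                 ≡⟨ filter-++ P? (upTo n) [ n ] ⟩
  filter P? (upTo n) ++ filter P? [ n ]                   ≡⟨ cong (_++ filter P? [ n ]) eq ⟩
  (filter P? (upTo k) ++ k ∷ suf) ++ filter P? [ n ]      ≡⟨ ++-assoc (filter P? (upTo k)) (k ∷ suf) _ ⟩
  filter P? (upTo k) ++ k ∷ suf ++ filter P? [ n ]        ∎)
  where open ≡-Reasoning

-- The position of a string

Sᵂ-zero : ∀ n → Sᵂ (suc n) 0 ≡ map (false ∷_) (Sᵂ n 0)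
Sᵂ-zero n = begin
  filter P? (map (false ∷_) (strings n) ++ map (true ∷_) (strings n))
    ≡⟨ filter-++ P? (map (false ∷_) (strings n)) _ ⟩
  filter P? (map (false ∷_) (strings n)) ++ filter P? (map (true ∷_) (strings n))
    ≡⟨ cong₂ _++_ (filter-map P? (false ∷_) (strings n)) (filter-map P? (true ∷_) (strings n)) ⟩
  map (false ∷_) (Sᵂ n 0) ++ map (true ∷_) (filter (P? ∘ (true ∷_)) (strings n))
    ≡⟨ cong (λ xs → map (false ∷_) (Sᵂ n 0) ++ map (true ∷_) xs) (filter-none (P? ∘ (true ∷_)) (All.universal (λ _ ()) (strings n))) ⟩
  map (false ∷_) (Sᵂ n 0) ++ []
    ≡⟨ ++-identityʳ _ ⟩
  map (false ∷_) (Sᵂ n 0) ∎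
  where
  open ≡-Reasoning
  P? = λ x → weight x ≟ 0

Sᵂ-suc : ∀ n i → Sᵂ (suc n) (suc i) ≡ map (false ∷_) (Sᵂ n (suc i)) ++ map (true ∷_) (Sᵂ n i)
Sᵂ-suc n i = begin
  filter P? (map (false ∷_) (strings n) ++ map (true ∷_) (strings n))
    ≡⟨ filter-++ P? (map (false ∷_) (strings n)) _ ⟩
  filter P? (map (false ∷_) (strings n)) ++ filter P? (map (true ∷_) (strings n))
    ≡⟨ cong₂ _++_ (filter-map P? (false ∷_) (strings n)) (filter-map P? (true ∷_) (strings n)) ⟩
  map (false ∷_) (Sᵂ n (suc i)) ++ map (true ∷_) (filter (P? ∘ (true ∷_)) (strings n))
    ≡⟨ cong (λ xs → map (false ∷_) (Sᵂ n (suc i)) ++ map (true ∷_) xs)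
         (filter-≐ (P? ∘ (true ∷_)) (λ x → weight x ≟ i) (suc-injective , cong suc) (strings n)) ⟩
  map (false ∷_) (Sᵂ n (suc i)) ++ map (true ∷_) (Sᵂ n i) ∎
  where
  open ≡-Reasoning
  P? = λ x → weight x ≟ suc i

length-Sᵂ : ∀ n i → length (Sᵂ n i) ≡ n C i
length-Sᵂ zero    zero    = refl
length-Sᵂ zero    (suc i) = refl
length-Sᵂ (suc n) zero    = trans (cong length (Sᵂ-zero n)) (trans (length-map (false ∷_) (Sᵂ n 0)) (length-Sᵂ n 0))
length-Sᵂ (suc n) (suc i) = begin
  length (Sᵂ (suc n) (suc i))                                                     ≡⟨ cong length (Sᵂ-suc n i) ⟩
  length (map (false ∷_) (Sᵂ n (suc i)) ++ map (true ∷_) (Sᵂ n i))                ≡⟨ length-++ (map (false ∷_) (Sᵂ n (suc i))) ⟩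
  length (map (false ∷_) (Sᵂ n (suc i))) + length (map (true ∷_) (Sᵂ n i))        ≡⟨ cong₂ _+_ (length-map _ (Sᵂ n (suc i))) (length-map _ (Sᵂ n i)) ⟩
  length (Sᵂ n (suc i)) + length (Sᵂ n i)                                         ≡⟨ cong₂ _+_ (length-Sᵂ n (suc i)) (length-Sᵂ n i) ⟩
  n C suc i + n C i                                                               ≡⟨ +-comm (n C suc i) _ ⟩
  n C i + n C suc i                                                               ≡⟨ nCk+nC[k+1]≡[n+1]C[k+1] n i ⟩
  suc n C suc i                                                                   ∎
  where open ≡-Reasoning

length-Rᵂ : ∀ n i → length (Rᵂ n i) ≡ n C i
length-Rᵂ n i = trans (length-reverse (Sᵂ n i)) (length-Sᵂ n i)

length-strings : ∀ n → length (strings n) ≡ 2 ^ n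
length-strings zero    = refl
length-strings (suc n) = begin
  length (map (false ∷_) (strings n) ++ map (true ∷_) (strings n))           ≡⟨ length-++ (map (false ∷_) (strings n)) ⟩
  length (map (false ∷_) (strings n)) + length (map (true ∷_) (strings n))   ≡⟨ cong₂ _+_ (length-map _ (strings n)) (length-map _ (strings n)) ⟩
  length (strings n) + length (strings n)                                    ≡⟨ cong (λ m → m + m) (length-strings n) ⟩
  2 ^ n + 2 ^ n                                                              ≡⟨ cong (2 ^ n +_) (+-identityʳ (2 ^ n)) ⟨
  2 ^ suc n                                                                  ∎
  where open ≡-Reasoning

-- The number of lexicographically larger strings of the same weight.
rank : ∀ {n} → BitString n → ℕ
rank []                    = 0
rank {suc n} (false ∷ x)   = n C⁻ weight x + rank x
rank (true ∷ x)            = rank x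

-- `Sᵂ` is increasing, so the larger strings are those that follow. Every string starting with
-- `true` follows `false ∷ x`; their tails have weight one less than `x`, which gives the term
-- `n C⁻ weight x`.
After-Sᵂ : ∀ {n} (x : BitString n) → After (rank x) x (Sᵂ n (weight x))
After-Sᵂ []                  = [] , [] , refl , refl
After-Sᵂ {suc n} (true ∷ x)  rewrite Sᵂ-suc n (weight x) =
  After-++ʳ (map (false ∷_) (Sᵂ n _)) (After-map (true ∷_) (After-Sᵂ x))
After-Sᵂ {suc n} (false ∷ x) with weight x | After-Sᵂ x
... | zero  | a rewrite Sᵂ-zero n = After-map (false ∷_) a
... | suc i | a rewrite Sᵂ-suc n i =
  subst (λ l → After (l + rank x) (false ∷ x) (map (false ∷_) (Sᵂ n (suc i)) ++ map (true ∷_) (Sᵂ n i)))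
        (trans (length-map _ (Sᵂ n i)) (length-Sᵂ n i))
        (After-++ˡ (map (true ∷_) (Sᵂ n i)) (After-map (false ∷_) a))

-- A general `g` serves `Rᵂ n` and `Sᵂ n` alike. Since `k` has parity `r`, passing from `upTo k` to
-- `upTo (suc (suc k))` admits exactly the weight `k`.
length-blocks : ∀ n (g : ℕ → List (BitString n)) → (∀ i → length (g i) ≡ n C i) → ∀ r k → k % 2 ≡ r →
                length (concat (map g (filter (λ i → i % 2 ≟ r) (upTo k)))) ≡ strideSum n k
length-blocks n g g≡ r zero       k%2≡r = refl
length-blocks n g g≡ r (suc zero) refl  = refl
length-blocks n g g≡ r (suc (suc k)) k%2≡r = begin
  length (concat (map g (filter P? (upTo (suc (suc k))))))                ≡⟨ cong (length ∘ concat ∘ map g) eq ⟩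
  length (concat (map g (filter P? (upTo k) ∷ʳ k)))                       ≡⟨ cong length (concat-map-++ g (filter P? (upTo k))) ⟩
  length (concat (map g (filter P? (upTo k))) ++ g k ++ [])               ≡⟨ length-++ (concat (map g (filter P? (upTo k)))) ⟩
  length (concat (map g (filter P? (upTo k)))) + length (g k ++ [])       ≡⟨ cong₂ _+_ (length-blocks n g g≡ r k k%2≡r) (trans (cong length (++-identityʳ (g k))) (g≡ k)) ⟩
  strideSum n k + n C k                                                   ∎
  where
  open ≡-Reasoning
  P? = λ i → i % 2 ≟ r

  1+k%2≢r : ∀ k → k % 2 ≡ r → suc k % 2 ≡ r → ⊥
  1+k%2≢r zero          refl ()
  1+k%2≢r (suc zero)    refl ()
  1+k%2≢r (suc (suc k)) p q = 1+k%2≢r k p q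

  eq : filter P? (upTo (suc (suc k))) ≡ filter P? (upTo k) ∷ʳ k
  eq = begin
    filter P? (upTo (suc (suc k)))                                    ≡⟨ cong (filter P?) (upTo-∷ʳ (suc k)) ⟨
    filter P? (upTo (suc k) ∷ʳ suc k)                                 ≡⟨ cong (λ ks → filter P? (ks ∷ʳ suc k)) (upTo-∷ʳ k) ⟨
    filter P? ((upTo k ∷ʳ k) ∷ʳ suc k)                                ≡⟨ cong (filter P?) (++-assoc (upTo k) [ k ] [ suc k ]) ⟩
    filter P? (upTo k ++ k ∷ [ suc k ])                               ≡⟨ filter-++ P? (upTo k) _ ⟩
    filter P? (upTo k) ++ filter P? (k ∷ [ suc k ])                   ≡⟨ cong (filter P? (upTo k) ++_) (filter-accept P? k%2≡r) ⟩
    filter P? (upTo k) ++ k ∷ filter P? [ suc k ]                     ≡⟨ cong (λ ks → filter P? (upTo k) ++ k ∷ ks) (filter-reject P? {suc k} {[]} (1+k%2≢r k k%2≡r)) ⟩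
    filter P? (upTo k) ∷ʳ k                                           ∎

S-split : ∀ n → S n ≡ concat (map (Rᵂ n) (oddWeights n)) ++ concat (map (Sᵂ n) (reverse (evenWeights n)))
S-split n = sym (concat-++ (map (Rᵂ n) (oddWeights n)) _)

weight<1+n : ∀ {n} (x : BitString n) → weight x < suc n
weight<1+n x = s≤s (count≤n (Bool._≟ true) x)

-- Odd blocks come first, by increasing weight and each in decreasing order. So `x` is preceded by
-- the lighter odd strings and by the larger strings of its own weight.
Before-S : ∀ {n} (x : BitString n) → weight x % 2 ≡ 1 → Before (strideSum n (weight x) + rank x) x (S n)
Before-S {n} x odd with filter-upTo-split (λ i → i % 2 ≟ 1) odd (suc n) (weight<1+n x)
... | suf , eq = subst₂ (λ k → Before k x)
  (cong (_+ rank x) (length-blocks n (Rᵂ n) (length-Rᵂ n) 1 (weight x) odd))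
  (sym (trans (S-split n) (cong (_++ evens) (trans (cong (concat ∘ map (Rᵂ n)) eq) (concat-map-++ (Rᵂ n) lighter)))))
  (Before-++ˡ evens (Before-++ʳ (concat (map (Rᵂ n) lighter)) (Before-++ˡ _ (After⇒Before-reverse (After-Sᵂ x)))))
  where
  lighter : List ℕ
  lighter = filter (λ i → i % 2 ≟ 1) (upTo (weight x))

  evens : List (BitString n)
  evens = concat (map (Sᵂ n) (reverse (evenWeights n)))

-- The mirror image of `Before-S`: even blocks end the sequence, by decreasing weight and each in
-- increasing order, so the same count now describes what follows `x`.
After-S : ∀ {n} (x : BitString n) → weight x % 2 ≡ 0 → After (strideSum n (weight x) + rank x) x (S n)
After-S {n} x even with filter-upTo-split (λ i → i % 2 ≟ 0) even (suc n) (weight<1+n x)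
... | suf , eq = subst₂ (λ k → After k x)
  (cong (_+ rank x) length-lighter)
  (sym (trans (S-split n) (cong (odds ++_) (trans (cong (concat ∘ map (Sᵂ n) ∘ reverse) eq) (concat-map-reverse (Sᵂ n) lighter)))))
  (After-++ʳ odds (After-++ʳ (concat (map (Sᵂ n) (reverse suf))) (After-++ˡ _ (After-Sᵂ x))))
  where
  open ≡-Reasoning
  lighter : List ℕ
  lighter = filter (λ i → i % 2 ≟ 0) (upTo (weight x))

  odds : List (BitString n)
  odds = concat (map (Rᵂ n) (oddWeights n))

  length-lighter : length (concat (map (Sᵂ n) (reverse lighter))) ≡ strideSum n (weight x)
  length-lighter = begin
    length (concat (map (Sᵂ n) (reverse lighter)))     ≡⟨ cong (length ∘ concat) (reverse-map (Sᵂ n) lighter) ⟩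
    length (concat (reverse (map (Sᵂ n) lighter)))     ≡⟨ length-concat-reverse (map (Sᵂ n) lighter) ⟩
    length (concat (map (Sᵂ n) lighter))               ≡⟨ length-blocks n (Sᵂ n) (length-Sᵂ n) 0 (weight x) even ⟩
    strideSum n (weight x)                             ∎

-- Labels of odd and even strings

ℓ : ∀ {n} → BitString n → ℕ
ℓ {n} = label (Q n) (f n)

label-index : ∀ {n} (x : BitString n) pre {suf} → S n ≡ pre ++ x ∷ suf → ℓ x ≡ suc (length pre)
label-index {n} x pre eq = cong suc (trans (toℕ-cast (length-S n) _) (index-unique (S-unique n) (S-complete x) pre eq))

label-odd : ∀ {n} (x : BitString n) → weight x % 2 ≡ 1 → ℓ x ≡ suc (strideSum n (weight x) + rank x)
label-odd x odd with Before-S x odd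
... | pre , suf , eq , k≡ = trans (label-index x pre eq) (cong suc k≡)

-- The label counts `x` and everything before it, the other summand everything after it.
label-even : ∀ {n} (x : BitString n) → weight x % 2 ≡ 0 → ℓ x + (strideSum n (weight x) + rank x) ≡ 2 ^ n
label-even {n} x even with After-S x even
... | pre , suf , eq , k≡ = begin
  ℓ x + (strideSum n (weight x) + rank x)          ≡⟨ cong₂ _+_ (label-index x pre eq) (sym k≡) ⟩
  suc (length pre + length suf)                    ≡⟨ +-suc (length pre) (length suf) ⟨
  length pre + length (x ∷ suf)                    ≡⟨ length-++ pre ⟨
  length (pre ++ x ∷ suf)                          ≡⟨ cong length eq ⟨
  length (S n)                                     ≡⟨ length-S n ⟩
  length (strings n)                               ≡⟨ length-strings n ⟩
  2 ^ n                                            ∎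
  where open ≡-Reasoning

-- Edges

-- An edge directed from its lighter to its heavier end: a shared prefix, the differing bit at
-- `flip`, and a shared tail `z`. Recursion on it walks along the prefix.
data Cover : ∀ {n} → BitString (suc n) → BitString (suc n) → Set where
  flip : ∀ {n} (z : BitString n) → Cover (false ∷ z) (true ∷ z)
  _∷_  : ∀ {n} {l h : BitString (suc n)} (b : Bool) → Cover l h → Cover (b ∷ l) (b ∷ h)

distance≡0⇒≡ : ∀ {n} (x y : BitString n) → distance x y ≡ 0 → x ≡ y
distance≡0⇒≡ []          []          _   = refl
distance≡0⇒≡ (false ∷ x) (false ∷ y) d≡0 = cong (false ∷_) (distance≡0⇒≡ x y d≡0)
distance≡0⇒≡ (true ∷ x)  (true ∷ y)  d≡0 = cong (true ∷_) (distance≡0⇒≡ x y d≡0)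

adjacent⇒cover : ∀ {n} (x y : BitString (suc n)) → distance x y ≡ 1 → Cover x y ⊎ Cover y x
adjacent⇒cover (false ∷ x) (true ∷ y) d≡1 with refl ← distance≡0⇒≡ x y (suc-injective d≡1) = inj₁ (flip x)
adjacent⇒cover (true ∷ x) (false ∷ y) d≡1 with refl ← distance≡0⇒≡ x y (suc-injective d≡1) = inj₂ (flip x)
adjacent⇒cover {suc n} (false ∷ x) (false ∷ y) d≡1 = Sum.map (false ∷_) (false ∷_) (adjacent⇒cover x y d≡1)
adjacent⇒cover {suc n} (true ∷ x)  (true ∷ y)  d≡1 = Sum.map (true ∷_) (true ∷_) (adjacent⇒cover x y d≡1)
adjacent⇒cover {zero} (false ∷ []) (false ∷ []) ()
adjacent⇒cover {zero} (true ∷ [])  (true ∷ [])  ()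

cover⇒adjacent : ∀ {n} {l h : BitString (suc n)} → Cover l h → distance l h ≡ 1
cover⇒adjacent (flip z)    = cong suc (distance-refl z)
cover⇒adjacent (false ∷ c) = cover⇒adjacent c
cover⇒adjacent (true ∷ c)  = cover⇒adjacent c

weight-cover : ∀ {n} {l h : BitString (suc n)} → Cover l h → weight h ≡ suc (weight l)
weight-cover (flip z)    = refl
weight-cover (false ∷ c) = weight-cover c
weight-cover (true ∷ c)  = cong suc (weight-cover c)

-- The quantity T of the proof idea above.
excess : ∀ {n} {l h : BitString (suc n)} → Cover l h → ℕ
excess (flip z)              = 0
excess (_∷_ {n} {l} {h} b c) = n C weight l + excess c

pascal-step : ∀ n k r s e → n C⁻ k + r ≡ s + e → suc n C k + r ≡ s + (n C k + e)
pascal-step n k r s e eq = begin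
  suc n C k + r              ≡⟨ cong (_+ r) (C⁻-pascal n k) ⟨
  n C⁻ k + n C k + r         ≡⟨ shuffle (n C⁻ k) (n C k) r ⟩
  n C k + (n C⁻ k + r)       ≡⟨ cong (n C k +_) eq ⟩
  n C k + (s + e)            ≡⟨ shuffle′ (n C k) s e ⟩
  s + (n C k + e)            ∎
  where
  open ≡-Reasoning
  shuffle : ∀ a b c → a + b + c ≡ b + (a + c)
  shuffle = solve-∀
  shuffle′ : ∀ a b c → a + (b + c) ≡ b + (a + c)
  shuffle′ = solve-∀

-- By `strideSum-suc`, `n C⁻ weight l` is the growth of `strideSum (suc n)` from `weight l` to
-- `weight h`. So the count `strideSum + rank` of `h` exceeds that of `l` by `excess c`. At `flip`
-- this is the definition of `rank`; each prefix bit contributes one application of Pascal's rule.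
rank-cover : ∀ {n} {l h : BitString (suc n)} (c : Cover l h) → n C⁻ weight l + rank h ≡ rank l + excess c
rank-cover (flip z) = sym (+-identityʳ _)
rank-cover (_∷_ {n} {l} {h} true c) = pascal-step n (weight l) (rank h) (rank l) (excess c) (rank-cover c)
rank-cover (_∷_ {n} {l} {h} false c) = begin
  suc n C⁻ weight l + (suc n C⁻ weight h + rank h)               ≡⟨ cong (λ w → suc n C⁻ weight l + (suc n C⁻ w + rank h)) (weight-cover c) ⟩
  suc n C⁻ weight l + (suc n C weight l + rank h)                ≡⟨ cong (suc n C⁻ weight l +_) (pascal-step n (weight l) (rank h) (rank l) (excess c) (rank-cover c)) ⟩
  suc n C⁻ weight l + (rank l + (n C weight l + excess c))       ≡⟨ +-assoc (suc n C⁻ weight l) (rank l) _ ⟨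
  suc n C⁻ weight l + rank l + (n C weight l + excess c)         ∎
  where open ≡-Reasoning

-- Sums of labels over edges

suc-even : ∀ k → k % 2 ≡ 0 → suc k % 2 ≡ 1
suc-even zero          _ = refl
suc-even (suc (suc k)) p = suc-even k p

suc-odd : ∀ k → k % 2 ≡ 1 → suc k % 2 ≡ 0
suc-odd (suc zero)    _ = refl
suc-odd (suc (suc k)) p = suc-odd k p

even⊎odd : ∀ k → k % 2 ≡ 0 ⊎ k % 2 ≡ 1
even⊎odd zero          = inj₁ refl
even⊎odd (suc zero)    = inj₂ refl
even⊎odd (suc (suc k)) = even⊎odd k

-- Here `l` is counted from the back and `h` from the front, so their counts enter with opposite
-- signs and only the difference `excess c` survives.
label-sum-even : ∀ {n} {l h : BitString (suc n)} (c : Cover l h) → weight l % 2 ≡ 0 →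
                 ℓ l + ℓ h ≡ 2 ^ suc n + suc (excess c)
-- `label-even` gives `ℓ l` only after its count is added, so that count is added to both sides and
-- cancelled.
label-sum-even {n} {l} {h} c even = +-cancelʳ-≡ (strideSum (suc n) w + rank l) _ _ (begin
  ℓ l + ℓ h + (s + rank l)                            ≡⟨ shuffle (ℓ l) (ℓ h) (s + rank l) ⟩
  ℓ l + (s + rank l) + ℓ h                            ≡⟨ cong₂ _+_ (label-even l even) (label-odd h (trans (cong (_% 2) (weight-cover c)) (suc-even w even))) ⟩
  2 ^ suc n + suc (strideSum (suc n) (weight h) + rank h)
                                                      ≡⟨ cong (λ k → 2 ^ suc n + suc (strideSum (suc n) k + rank h)) (weight-cover c) ⟩
  2 ^ suc n + suc (strideSum (suc n) (suc w) + rank h)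
                                                      ≡⟨ cong (λ t → 2 ^ suc n + suc (t + rank h)) (strideSum-suc n w) ⟩
  2 ^ suc n + suc (s + n C⁻ w + rank h)               ≡⟨ cong (λ t → 2 ^ suc n + suc t) (trans (+-assoc s (n C⁻ w) (rank h)) (cong (s +_) (rank-cover c))) ⟩
  2 ^ suc n + suc (s + (rank l + excess c))           ≡⟨ shuffle′ (2 ^ suc n) s (rank l) (excess c) ⟩
  2 ^ suc n + suc (excess c) + (s + rank l)           ∎)
  where
  open ≡-Reasoning
  w = weight l
  s = strideSum (suc n) w
  shuffle : ∀ a b c → a + b + c ≡ a + c + b
  shuffle = solve-∀
  shuffle′ : ∀ a b c d → a + suc (b + (c + d)) ≡ a + suc d + (b + c)
  shuffle′ = solve-∀

-- The two ends exchange roles, so the excess changes sign; it stands on the left to avoid truncated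
-- subtraction.
label-sum-odd : ∀ {n} {l h : BitString (suc n)} (c : Cover l h) → weight l % 2 ≡ 1 →
                ℓ l + ℓ h + excess c ≡ suc (2 ^ suc n)
label-sum-odd {n} {l} {h} c odd = +-cancelʳ-≡ (s + rank l) _ _ (begin
  ℓ l + ℓ h + excess c + (s + rank l)                 ≡⟨ shuffle (ℓ l) (ℓ h) (excess c) s (rank l) ⟩
  ℓ l + (ℓ h + (s + (rank l + excess c)))             ≡⟨ cong (λ t → ℓ l + (ℓ h + t)) (trans (cong (s +_) (sym (rank-cover c))) (sym (+-assoc s (n C⁻ w) (rank h)))) ⟩
  ℓ l + (ℓ h + (s + n C⁻ w + rank h))                 ≡⟨ cong (λ t → ℓ l + (ℓ h + (t + rank h))) (strideSum-suc n w) ⟨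
  ℓ l + (ℓ h + (strideSum (suc n) (suc w) + rank h))  ≡⟨ cong (λ k → ℓ l + (ℓ h + (strideSum (suc n) k + rank h))) (weight-cover c) ⟨
  ℓ l + (ℓ h + (strideSum (suc n) (weight h) + rank h))
                                                      ≡⟨ cong₂ _+_ (label-odd l odd) (label-even h (trans (cong (_% 2) (weight-cover c)) (suc-odd w odd))) ⟩
  suc (s + rank l) + 2 ^ suc n                        ≡⟨ cong suc (+-comm (s + rank l) (2 ^ suc n)) ⟩
  suc (2 ^ suc n) + (s + rank l)                      ∎)
  where
  open ≡-Reasoning
  w = weight l
  s = strideSum (suc n) w
  shuffle : ∀ a b c d e → a + b + c + (d + e) ≡ a + (b + (d + (e + c)))
  shuffle = solve-∀

label-sum≤ : ∀ {n} {l h : BitString (suc n)} (c : Cover l h) → ℓ l + ℓ h ≤ 2 ^ suc n + suc (excess c)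
label-sum≤ {n} {l} {h} c with even⊎odd (weight l)
... | inj₁ even = ≤-reflexive (label-sum-even c even)
... | inj₂ odd  = begin
  ℓ l + ℓ h                      ≤⟨ m≤m+n _ (excess c) ⟩
  ℓ l + ℓ h + excess c           ≡⟨ label-sum-odd c odd ⟩
  suc (2 ^ suc n)                ≤⟨ s≤s (m≤m+n _ (excess c)) ⟩
  suc (2 ^ suc n + excess c)     ≡⟨ +-suc _ (excess c) ⟨
  2 ^ suc n + suc (excess c)     ∎
  where open ≤-Reasoning

-- Lower bounds on the strength

label-sum≤str : ∀ {n} (x y : BitString n) → Adj (Q n) x y → ℓ x + ℓ y ≤ str (Q n) (f n)
label-sum≤str {n} x y x~y = All.lookup (xs≤max 0 _) (∈-map⁺ (λ (u , v) → ℓ u + ℓ v)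
  (∈-filter⁺ (uncurry (FiniteGraph.adj? (Q n))) (∈-cartesianProduct⁺ (strings-complete x) (strings-complete y)) x~y))

even-excess≤str : ∀ {n} {l h : BitString (suc n)} (c : Cover l h) → weight l % 2 ≡ 0 →
                  2 ^ suc n + suc (excess c) ≤ str (Q (suc n)) (f (suc n))
even-excess≤str {l = l} {h} c even =
  ≤-trans (≤-reflexive (sym (label-sum-even c even))) (label-sum≤str l h (cover⇒adjacent c))

weight-zeros : ∀ n → weight (replicate n false) ≡ 0
weight-zeros zero    = refl
weight-zeros (suc n) = weight-zeros n

-- Witnessed by the edge between the zero string and 10...0, whose excess is 0 and whose lighter end
-- has even weight.
2^n+1≤str : ∀ n → 2 ^ suc n + 1 ≤ str (Q (suc n)) (f (suc n))
2^n+1≤str n = even-excess≤str (flip (replicate n false)) (cong (_% 2) (weight-zeros n))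

excess≤str : ∀ {n} {l h : BitString (suc n)} (c : Cover l h) →
             2 ^ suc n + suc (excess c) ≤ str (Q (suc n)) (f (suc n))
-- The first bit is the differing one and cannot be chosen freely, but the excess is 0.
excess≤str {n} (flip z) = 2^n+1≤str n
excess≤str (_∷_ {l = l} _ c) with even⊎odd (weight l)
... | inj₁ even = even-excess≤str (false ∷ c) even
... | inj₂ odd  = even-excess≤str (true ∷ c) (suc-odd (weight l) odd)

-- Deleting the first two bits

excess-step : ∀ {k} {l h : BitString (3 + k)} (c : Cover l h) →
              2 ^ suc k + suc (excess c) ≤
              str (Q (suc k)) (f (suc k)) + (k C ⌈ k /2⌉) + (suc k C ⌈ suc k /2⌉)
excess-step {k} (flip z) = ≤-trans (2^n+1≤str k) (≤-trans (m≤m+n _ _) (m≤m+n _ _))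
-- The differing bit is among the deleted ones, so no edge of the smaller cube remains; `2^n+1≤str`
-- stands in for it, and the single term of the excess is at most the larger central binomial.
excess-step {k} (b ∷ flip z) = begin
  2 ^ suc k + suc (suc k C weight z + 0)                    ≡⟨ shuffle (2 ^ suc k) (suc k C weight z) ⟩
  2 ^ suc k + 1 + suc k C weight z                          ≤⟨ +-mono-≤ (≤-trans (2^n+1≤str k) (m≤m+n _ _)) (nCk≤nC⌈n/2⌉ (suc k) (weight z)) ⟩
  str (Q (suc k)) (f (suc k)) + (k C ⌈ k /2⌉) + (suc k C ⌈ suc k /2⌉) ∎
  where
  open ≤-Reasoning
  shuffle : ∀ a b → a + suc (b + 0) ≡ a + 1 + b
  shuffle = solve-∀
-- The edge `c` survives in the smaller cube, and exactly two terms of the excess are lost.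
excess-step {k} (b ∷ (_∷_ {l = l} b′ c)) = begin
  2 ^ suc k + suc (suc k C v + (k C w + excess c))          ≡⟨ shuffle (2 ^ suc k) (suc k C v) (k C w) (excess c) ⟩
  2 ^ suc k + suc (excess c) + k C w + suc k C v            ≤⟨ +-mono-≤ (+-mono-≤ (excess≤str c) (nCk≤nC⌈n/2⌉ k w)) (nCk≤nC⌈n/2⌉ (suc k) v) ⟩
  str (Q (suc k)) (f (suc k)) + (k C ⌈ k /2⌉) + (suc k C ⌈ suc k /2⌉) ∎
  where
  open ≤-Reasoning
  v = weight (b′ ∷ l)
  w = weight l
  shuffle : ∀ a b c d → a + suc (b + (c + d)) ≡ a + suc d + c + b
  shuffle = solve-∀

cover-bound : ∀ {k} {l h : BitString (3 + k)} → Cover l h →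
              ℓ l + ℓ h ≤ str (Q (suc k)) (f (suc k)) + 3 * 2 ^ suc k + (k C ⌈ k /2⌉) + (suc k C ⌈ suc k /2⌉)
cover-bound {k} {l} {h} c = begin
  ℓ l + ℓ h                                             ≤⟨ label-sum≤ c ⟩
  -- Of the four copies of `2 ^ suc k` in `2 ^ (3 + k)`, one is passed on to `excess-step`.
  2 ^ (3 + k) + suc (excess c)                          ≡⟨ shuffle (2 ^ suc k) (suc (excess c)) ⟩
  3 * 2 ^ suc k + (2 ^ suc k + suc (excess c))          ≤⟨ +-monoʳ-≤ (3 * 2 ^ suc k) (excess-step c) ⟩
  3 * 2 ^ suc k + (s + m + m′)                          ≡⟨ shuffle′ (3 * 2 ^ suc k) s m m′ ⟩
  s + 3 * 2 ^ suc k + m + m′                            ∎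
  where
  open ≤-Reasoning
  s  = str (Q (suc k)) (f (suc k))
  m  = k C ⌈ k /2⌉
  m′ = suc k C ⌈ suc k /2⌉
  shuffle : ∀ a b → 2 * (2 * a) + b ≡ 3 * a + (a + b)
  shuffle = solve-∀
  shuffle′ : ∀ a b c d → a + (b + c + d) ≡ b + a + c + d
  shuffle′ = solve-∀

theorem2p4 : (n : ℕ) → 5 ≤ n →
    (x y : Vertex (Q n)) → Adj (Q n) x y →
    label (Q n) (f n) x + label (Q n) (f n) y ≡ str (Q n) (f n) →
    BeginsWith false x → BeginsWith false y →
    str (Q n) (f n) ≤ str (Q (n ∸ 2)) (f (n ∸ 2)) + 3 * 2 ^ (n ∸ 2) + ((n ∸ 3) C ⌈ (n ∸ 3) /2⌉) + ((n ∸ 2) C ⌈ (n ∸ 2) /2⌉)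
-- The edge attains the strength, so bounding its label sum is enough. With n = 3 + k, `n ∸ 2` and
-- `n ∸ 3` reduce to `suc k` and `k`.
theorem2p4 (suc (suc (suc k))) _ x y x~y max _ _ = ≤-trans (≤-reflexive (sym max)) ([ cover-bound , cover-bound′ ]′ (adjacent⇒cover x y x~y))
  where
  cover-bound′ : Cover y x → ℓ x + ℓ y ≤ str (Q (suc k)) (f (suc k)) + 3 * 2 ^ suc k + (k C ⌈ k /2⌉) + (suc k C ⌈ suc k /2⌉)
  cover-bound′ c = ≤-trans (≤-reflexive (+-comm (ℓ x) (ℓ y))) (cover-bound c)
theorem2p4 (suc (suc zero)) (s≤s (s≤s ()))
theorem2p4 (suc zero) (s≤s ())
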